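{- Let $\star\in\{\boxtimes,\circ\}$, $k$ a positive integer, $G,H$ graphs of orders $n_G,n_H$, $M_G\subseteq E_G$, $M_H\subseteq E_H$, and let $u_G,u_H$ be the numbers of $M_G$-unmatched vertices of $G$ and $M_H$-unmatched vertices of $H$. If $F_{\circledast}(M_G,M_H)$ is a $k$-matching of $G\star H$, then $F_{\circledast}(M_G,M_H)\in\mathcal{W}_k(G\star H,M_G,M_H)$ and $|F_{\circledast}(M_G,M_H)|\ge|M|$ for all $M\in\mathcal{W}_k(G\star H,M_G,M_H)$. Moreover, if $M_G,M_H$ satisfy one of the conditions (M1)–(M4) below, then every maximum-cardinality element $M^*$ of $\mathcal{W}_k(G\star H,M_G,M_H)$ satisfies $|M^*|=\frac{k}{2}(n_Gn_H-u_Gu_H)$. Conditions: (M1)(a) $M_G$ perfect $k$-matching of $G$ and $M_H$ non-empty $1$-matching of $H$, or (M1)(b) $M_G$ non-empty $k$-matching of $G$ and $M_H=\emptyset$; (M2)(a) $M_G$ non-empty $1$-matching of $G$ and $M_H$ perfect $k$-matching of $H$, or (M2)(b) $M_G=\emptyset$ and $M_H$ non-empty $k$-matching of $H$; (M3) $k=1$ and $M_G,M_H$ are $1$-matchings; (M4) $M_G$ perfect $k_G$-matching and $M_H$ perfect $k_H$-matching with positive integers $k_Gk_H=k$.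
   Context: Graphs are finite, simple, undirected, with non-empty vertex set. For a positive integer $k$, a $k$-matching of $G=(V,E)$ is a set $M\subseteq E$ such that every vertex is incident to either $0$ or exactly $k$ edges of $M$; a vertex incident to no edge of $M$ is $M$-unmatched; $M$ is perfect if there are no unmatched vertices. Products on $V_G\times V_H$: in $G\boxtimes H$, $(g,h)\sim(g',h')$ iff (i) $\{g,g'\}\in E_G$, $h=h'$; or (ii) $g=g'$, $\{h,h'\}\in E_H$; or (iii) $\{g,g'\}\in E_G$ and $\{h,h'\}\in E_H$; in $G\circ H$ iff $\{g,g'\}\in E_G$ or (ii). With $U_G,U_H$ the unmatched vertex sets: $F_{\ast}(M_G,M_H)=\{\{(g,h),(g',h')\}:\{g,g'\}\in M_G,\{h,h'\}\in M_H\}$, $M^{U}_G=\{\{(u,h),(u,h')\}:u\in U_G,\{h,h'\}\in M_H\}$, $M^{U}_H=\{\{(g,u),(g',u)\}:u\in U_H,\{g,g'\}\in M_G\}$, $F_{\circledast}(M_G,M_H)=F_{\ast}(M_G,M_H)\cup M^{U}_G\cup M^{U}_H$. Projections: for an edge $e=\{(g,h),(g',h')\}$, $p_G(e)=\{g,g'\}$ if $g\ne g'$ and $p_G(e)=g$ if $g=g'$; similarly $p_H(e)$. A set $M\subseteq E_{G\star H}$ is weak-homomorphism preserving w.r.t. $M_G,M_H$ if $p_G(e)\in M_G\cup V_G$ and $p_H(e)\in M_H\cup V_H$ for all $e\in M$. $\mathcal{W}_k(G\star H,M_G,M_H)$ is the set of all $k$-matchings of $G\star H$ that are weak-homomorphism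 preserving w.r.t. $M_G,M_H$. -}

module Defs where

open import Data.Fin.Base using (Fin)
import Data.Fin.Properties as Fin
open import Data.List.Base using (List; length; filter; tabulate; allFin; cartesianProduct)
open import Data.Nat.Base using (ℕ; _*_; _≤_; NonZero)
open import Data.Nat.Properties using (m*n≢0)
open import Data.Product.Base using (_×_; _,_; ∃₂)
open import Data.Product.Function.NonDependent.Propositional using (_×-↔_)
open import Data.Sum.Base using (_⊎_; inj₁; inj₂)
open import Data.Unit.Base using (⊤)
open import Function.Bundles using (_↔_; module Inverse)
open import Function.Construct.Symmetry using (↔-sym)
open import Function.Properties.Inverse using (↔-trans; ↔⇒↣)
open import Level using (0ℓ)
open import Relation.Binary.Core using (Rel)
open import Relation.Binary.Definitions using (Decidable; DecidableEquality; Symmetric)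
open import Relation.Binary.PropositionalEquality using (_≡_; refl; sym; subst)
open import Relation.Nullary using (¬_; Dec; yes; no; ¬?; _×-dec_; _⊎-dec_)
open import Relation.Nullary.Decidable using (map′)
import Relation.Unary as U

-- Vertices form an arbitrary finite type rather than Fin n, so that a product
-- graph literally has the vertex set V G × V H.

record Graph : Set₁ where
  field
    V        : Set
    order    : ℕ
    enum     : Fin order ↔ V
    nonEmpty : NonZero order
    Adj      : Rel V 0ℓ
    Adj?     : Decidable Adj
    symm     : Symmetric Adj
    irrefl   : ∀ {x} → ¬ Adj x x

  vertex# : Fin order → V
  vertex# = Inverse.to enum

  vertices : List V
  vertices = tabulate vertex#

  infix 4 _≟_
  _≟_ : DecidableEquality V
  _≟_ = Fin.inj⇒≟ (↔⇒↣ (↔-sym enum))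

  allVertices? : {P : V → Set} → U.Decidable P → Dec (∀ v → P v)
  allVertices? {P} P? = map′
    (λ f v → subst P (Inverse.strictlyInverseˡ enum v) (f (Inverse.from enum v)))
    (λ f i → f (vertex# i))
    (Fin.all? (λ i → P? (vertex# i)))

open Graph using (V; order)

-- A subset of the edge set E_G.  The unordered pair {x , y} belongs to the
-- subset iff  x ~ y  holds; the symmetry of _~_ makes this well defined.

record EdgeSet (G : Graph) : Set₁ where
  infix 4 _~_ _~?_
  field
    _~_   : Rel (V G) 0ℓ
    _~?_  : Decidable _~_
    ~-sym : Symmetric _~_
    ~⊆E   : ∀ {x y} → x ~ y → Graph.Adj G x y

open EdgeSet using (~-sym; ~⊆E)

infix 4 _⟨_~_⟩
_⟨_~_⟩ : {G : Graph} → EdgeSet G → V G → V G → Set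
M ⟨ x ~ y ⟩ = EdgeSet._~_ M x y

module _ {G : Graph} where

  open Graph G using (vertex#; vertices; allVertices?)

  Empty : EdgeSet G → Set
  Empty M = ∀ x y → ¬ (M ⟨ x ~ y ⟩)

  NonEmpty : EdgeSet G → Set
  NonEmpty M = ∃₂ λ x y → M ⟨ x ~ y ⟩

  -- Each edge {x , y} is counted once, in the orientation in which x precedes
  -- y in the enumeration of the vertices.
  ∣_∣ : EdgeSet G → ℕ
  ∣ M ∣ = length (filter
    (λ (i , j) → (i Fin.<? j) ×-dec EdgeSet._~?_ M (vertex# i) (vertex# j))
    (cartesianProduct (allFin (order G)) (allFin (order G))))

  -- The edges incident to x correspond to the vertices y with x ~ y.
  degree : EdgeSet G → V G → ℕ
  degree M x = length (filter (EdgeSet._~?_ M x) vertices)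

  Unmatched : EdgeSet G → V G → Set
  Unmatched M x = ∀ y → ¬ (M ⟨ x ~ y ⟩)

  unmatched? : (M : EdgeSet G) → U.Decidable (Unmatched M)
  unmatched? M x = allVertices? (λ y → ¬? (EdgeSet._~?_ M x y))

  unmatchedCount : EdgeSet G → ℕ
  unmatchedCount M = length (filter (unmatched? M) vertices)

  IsMatching : ℕ → EdgeSet G → Set
  IsMatching k M = ∀ x → degree M x ≡ 0 ⊎ degree M x ≡ k

  IsPerfectMatching : ℕ → EdgeSet G → Set
  IsPerfectMatching k M = IsMatching k M × (∀ x → ¬ Unmatched M x)

  infixr 6 _∪_
  _∪_ : EdgeSet G → EdgeSet G → EdgeSet G
  M ∪ N = record
    { _~_   = λ x y → M ⟨ x ~ y ⟩ ⊎ N ⟨ x ~ y ⟩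
    ; _~?_  = λ x y → EdgeSet._~?_ M x y ⊎-dec EdgeSet._~?_ N x y
    ; ~-sym = λ { (inj₁ p) → inj₁ (~-sym M p) ; (inj₂ q) → inj₂ (~-sym N q) }
    ; ~⊆E   = λ { (inj₁ p) → ~⊆E M p ; (inj₂ q) → ~⊆E N q }
    }

data ProductKind : Set where
  ⊠ ∘ : ProductKind

module _ (G H : Graph) where

  private
    module G = Graph G
    module H = Graph H

  ProductAdj : ProductKind → Rel (V G × V H) 0ℓ
  ProductAdj ⊠ (g , h) (g′ , h′) =
    (G.Adj g g′ × h ≡ h′) ⊎ (g ≡ g′ × H.Adj h h′) ⊎ (G.Adj g g′ × H.Adj h h′)
  ProductAdj ∘ (g , h) (g′ , h′) =
    G.Adj g g′ ⊎ (g ≡ g′ × H.Adj h h′)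

  productAdj? : ∀ ⋆ → Decidable (ProductAdj ⋆)
  productAdj? ⊠ (g , h) (g′ , h′) =
    (G.Adj? g g′ ×-dec h H.≟ h′) ⊎-dec
    (g G.≟ g′ ×-dec H.Adj? h h′) ⊎-dec
    (G.Adj? g g′ ×-dec H.Adj? h h′)
  productAdj? ∘ (g , h) (g′ , h′) =
    G.Adj? g g′ ⊎-dec (g G.≟ g′ ×-dec H.Adj? h h′)

  productAdj-sym : ∀ ⋆ → Symmetric (ProductAdj ⋆)
  productAdj-sym ⊠ (inj₁ (a , e))        = inj₁ (G.symm a , sym e)
  productAdj-sym ⊠ (inj₂ (inj₁ (e , b))) = inj₂ (inj₁ (sym e , H.symm b))
  productAdj-sym ⊠ (inj₂ (inj₂ (a , b))) = inj₂ (inj₂ (G.symm a , H.symm b))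
  productAdj-sym ∘ (inj₁ a)              = inj₁ (G.symm a)
  productAdj-sym ∘ (inj₂ (e , b))        = inj₂ (sym e , H.symm b)

  productAdj-irrefl : ∀ ⋆ {x} → ¬ ProductAdj ⋆ x x
  productAdj-irrefl ⊠ (inj₁ (a , _))        = G.irrefl a
  productAdj-irrefl ⊠ (inj₂ (inj₁ (_ , b))) = H.irrefl b
  productAdj-irrefl ⊠ (inj₂ (inj₂ (a , _))) = G.irrefl a
  productAdj-irrefl ∘ (inj₁ a)              = G.irrefl a
  productAdj-irrefl ∘ (inj₂ (_ , b))        = H.irrefl b

-- product ⊠ G H is the strong product, product ∘ G H the lexicographic product.
product : ProductKind → Graph → Graph → Graph
product ⋆ G H = record
  { V        = V G × V H
  ; order    = order G * order H
  ; enum     = ↔-trans Fin.*↔× (Graph.enum G ×-↔ Graph.enum H)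
  ; nonEmpty = m*n≢0 (order G) (order H) {{Graph.nonEmpty G}} {{Graph.nonEmpty H}}
  ; Adj      = ProductAdj G H ⋆
  ; Adj?     = productAdj? G H ⋆
  ; symm     = productAdj-sym G H ⋆
  ; irrefl   = productAdj-irrefl G H ⋆
  }

module _ (⋆ : ProductKind) {G H : Graph} (MG : EdgeSet G) (MH : EdgeSet H) where

  private
    module MG = EdgeSet MG
    module MH = EdgeSet MH
    both : ∀ ⋆ {g g′ h h′} → Graph.Adj G g g′ → Graph.Adj H h h′ →
           ProductAdj G H ⋆ (g , h) (g′ , h′)
    both ⊠ a b = inj₂ (inj₂ (a , b))
    both ∘ a b = inj₁ a
    right : ∀ ⋆ {g g′ h h′} → g ≡ g′ → Graph.Adj H h h′ →
            ProductAdj G H ⋆ (g , h) (g′ , h′)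
    right ⊠ e b = inj₂ (inj₁ (e , b))
    right ∘ e b = inj₂ (e , b)
    left : ∀ ⋆ {g g′ h h′} → Graph.Adj G g g′ → h ≡ h′ →
           ProductAdj G H ⋆ (g , h) (g′ , h′)
    left ⊠ a e = inj₁ (a , e)
    left ∘ a e = inj₁ a

  F∗ : EdgeSet (product ⋆ G H)
  F∗ = record
    { _~_   = λ (g , h) (g′ , h′) → MG ⟨ g ~ g′ ⟩ × MH ⟨ h ~ h′ ⟩
    ; _~?_  = λ (g , h) (g′ , h′) → (g MG.~? g′) ×-dec (h MH.~? h′)
    ; ~-sym = λ (a , b) → MG.~-sym a , MH.~-sym b
    ; ~⊆E   = λ (a , b) → both ⋆ (MG.~⊆E a) (MH.~⊆E b)
    }

  MᵁG : EdgeSet (product ⋆ G H)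
  MᵁG = record
    { _~_   = λ (g , h) (g′ , h′) → g ≡ g′ × Unmatched MG g × MH ⟨ h ~ h′ ⟩
    ; _~?_  = λ (g , h) (g′ , h′) →
                (Graph._≟_ G g g′) ×-dec unmatched? MG g ×-dec (h MH.~? h′)
    ; ~-sym = λ { (refl , u , b) → refl , u , MH.~-sym b }
    ; ~⊆E   = λ (e , _ , b) → right ⋆ e (MH.~⊆E b)
    }

  MᵁH : EdgeSet (product ⋆ G H)
  MᵁH = record
    { _~_   = λ (g , h) (g′ , h′) → h ≡ h′ × Unmatched MH h × MG ⟨ g ~ g′ ⟩
    ; _~?_  = λ (g , h) (g′ , h′) →
                (Graph._≟_ H h h′) ×-dec unmatched? MH h ×-dec (g MG.~? g′)
    ; ~-sym = λ { (refl , u , a) → refl , u , MG.~-sym a }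
    ; ~⊆E   = λ (e , _ , a) → left ⋆ (MG.~⊆E a) e
    }

  F⊛ : EdgeSet (product ⋆ G H)
  F⊛ = F∗ ∪ MᵁG ∪ MᵁH

-- The value of a projection pG(e): a vertex, or an unordered pair {x , y}
-- given by one of its two orderings.
data VertexOrPair (A : Set) : Set where
  vertex : A → VertexOrPair A
  pair   : A → A → VertexOrPair A

collapse : (G : Graph) → V G → V G → VertexOrPair (V G)
collapse G x y with Graph._≟_ G x y
... | yes _ = vertex x
... | no  _ = pair x y

pG : (G H : Graph) → (x y : V G × V H) → VertexOrPair (V G)
pG G H (g , _) (g′ , _) = collapse G g g′

pH : (G H : Graph) → (x y : V G × V H) → VertexOrPair (V H)
pH G H (_ , h) (_ , h′) = collapse H h h′

infix 4 _∈_∪V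
_∈_∪V : {G : Graph} → VertexOrPair (V G) → EdgeSet G → Set
vertex _ ∈ M ∪V = ⊤
pair x y ∈ M ∪V = M ⟨ x ~ y ⟩

module _ (⋆ : ProductKind) {G H : Graph} (MG : EdgeSet G) (MH : EdgeSet H) where

  WeakHomPreserving : EdgeSet (product ⋆ G H) → Set
  WeakHomPreserving M = ∀ x y → M ⟨ x ~ y ⟩ →
    (pG G H x y ∈ MG ∪V) × (pH G H x y ∈ MH ∪V)

  -- W k M  means  M ∈ 𝒲_k(G ⋆ H, MG, MH).
  W : ℕ → EdgeSet (product ⋆ G H) → Set
  W k M = IsMatching k M × WeakHomPreserving M

  IsMaximumW : ℕ → EdgeSet (product ⋆ G H) → Set₁
  IsMaximumW k M = W k M × (∀ N → W k N → ∣ N ∣ ≤ ∣ M ∣)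

data Condition (k : ℕ) {G H : Graph} (MG : EdgeSet G) (MH : EdgeSet H) : Set where
  M1a : IsPerfectMatching k MG → IsMatching 1 MH → NonEmpty MH → Condition k MG MH
  M1b : IsMatching k MG → NonEmpty MG → Empty MH → Condition k MG MH
  M2a : IsMatching 1 MG → NonEmpty MG → IsPerfectMatching k MH → Condition k MG MH
  M2b : Empty MG → IsMatching k MH → NonEmpty MH → Condition k MG MH
  M3  : k ≡ 1 → IsMatching 1 MG → IsMatching 1 MH → Condition k MG MH
  M4  : (kG kH : ℕ) → NonZero kG → NonZero kH → kG * kH ≡ k →
        IsPerfectMatching kG MG → IsPerfectMatching kH MH → Condition k MG MH

{-# OPTIONS --safe #-}

-- Double counting incidences turns the size of a k-matching into its number u of
-- unmatched vertices: 2∣M∣ = k (n ∸ u).  A vertex (g , h) is F⊛-unmatched exactly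
-- when g and h are both unmatched, and such a vertex is unmatched in every
-- weak-homomorphism preserving edge set, so F⊛ has the fewest unmatched vertices,
-- namely u_G u_H.  Each of (M1)–(M4) makes F⊛ a k-matching because its degree at
-- (g , h) is the product of the degrees of g and h if both are matched, and the
-- degree of the other vertex if one of them is unmatched.

module Submission where

open import Defs
open import Data.Bool.Base using (Bool; true; false)
open import Data.Fin.Base using (Fin; zero; suc; splitAt; remQuot)
import Data.Fin.Properties as Fin
open import Data.List.Base using (List; []; _∷_; _++_; length; filter; tabulate; map; cartesianProduct)
open import Data.List.Properties using (filter-++; length-++; filter-none; filter-some)
import Data.List.Relation.Unary.All.Properties as All
import Data.List.Relation.Unary.Any.Properties as Any
open import Data.Nat.Base using (ℕ; suc; _+_; _*_; _∸_; _≤_; NonZero; z≤n)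
open import Data.Nat.Properties
open import Data.Product.Base using (_×_; _,_; proj₁; proj₂; uncurry)
open import Data.Sum.Base using (_⊎_; inj₁; inj₂; [_,_]′)
open import Data.Sum.Properties using ([,]-map)
open import Data.Unit.Base using (tt)
open import Function.Base using (_∘′_)
open import Function.Bundles using (module Inverse; _⇔_; mk⇔; module Equivalence)
open import Relation.Binary.Definitions using (tri<; tri≈; tri>)
open import Relation.Binary.PropositionalEquality using (_≡_; refl; sym; trans; cong; cong₂; subst; module ≡-Reasoning)
open import Relation.Nullary using (¬_; Dec; yes; no; does; contradiction; _×-dec_)
open import Relation.Nullary.Decidable using (does-⇔; toSum)
import Relation.Unary as U

open import Algebra.Properties.Semiring.Sum +-*-semiring

open Graph using (V; order; vertex#; vertices)
open EdgeSet using (~-sym; ~⊆E; _~?_)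

-- Sums over Fin

sum-mono-≤ : ∀ {n} {f g : Fin n → ℕ} → (∀ i → f i ≤ g i) → sum f ≤ sum g
sum-mono-≤ {0}     f≤g = z≤n
sum-mono-≤ {suc n} f≤g = +-mono-≤ (f≤g zero) (sum-mono-≤ (λ i → f≤g (suc i)))

sum-const : ∀ n c → sum {n} (λ _ → c) ≡ n * c
sum-const 0       c = refl
sum-const (suc n) c = cong (c +_) (sum-const n c)

sum-splitAt : ∀ m {n} (f : Fin m → ℕ) (g : Fin n → ℕ) →
              sum ([ f , g ]′ ∘′ splitAt m) ≡ sum f + sum g
sum-splitAt 0       f g = refl
sum-splitAt (suc m) f g = begin
  f zero + sum (λ i → [ f , g ]′ (splitAt (suc m) (suc i)))
    ≡⟨ cong (f zero +_) (sum-cong-≗ (λ i → [,]-map (splitAt m i))) ⟩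
  f zero + sum ([ f ∘′ suc , g ]′ ∘′ splitAt m)
    ≡⟨ cong (f zero +_) (sum-splitAt m (f ∘′ suc) g) ⟩
  f zero + (sum (f ∘′ suc) + sum g)
    ≡⟨ +-assoc (f zero) _ _ ⟨
  sum f + sum g ∎
  where open ≡-Reasoning

-- `remQuot` is the map by which a product graph enumerates its vertices, so this turns sums over a
-- product into double sums. Induction on `m` peels off the first block of `n` indices with
-- `splitAt`.
sum-remQuot : ∀ m n (f : Fin m → Fin n → ℕ) →
              sum (λ i → uncurry f (remQuot {m} n i)) ≡ ∑[ i < m ] ∑[ j < n ] f i j
sum-remQuot 0       n f = refl
sum-remQuot (suc m) n f = begin
  sum (λ i → uncurry f (remQuot {suc m} n i))
    ≡⟨ sum-cong-≗ split ⟩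
  sum ([ f zero , (λ i → uncurry (f ∘′ suc) (remQuot {m} n i)) ]′ ∘′ splitAt n)
    ≡⟨ sum-splitAt n (f zero) _ ⟩
  sum (f zero) + sum (λ i → uncurry (f ∘′ suc) (remQuot {m} n i))
    ≡⟨ cong (sum (f zero) +_) (sum-remQuot m n (f ∘′ suc)) ⟩
  ∑[ i < suc m ] ∑[ j < n ] f i j ∎
  where
  open ≡-Reasoning
  split : ∀ i → uncurry f (remQuot {suc m} n i) ≡
                [ f zero , (λ i → uncurry (f ∘′ suc) (remQuot {m} n i)) ]′ (splitAt n i)
  split i with splitAt n i
  ... | inj₁ _ = refl
  ... | inj₂ _ = refl

sum-*-sum : ∀ {m n} (f : Fin m → ℕ) (g : Fin n → ℕ) →
            ∑[ i < m ] ∑[ j < n ] (f i * g j) ≡ sum f * sum g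
sum-*-sum f g = trans (sum-cong-≗ (λ i → sym (*-distribˡ-sum (f i) g)))
                      (sym (*-distribʳ-sum (sum g) f))

-- Counting as a sum of indicators

bit : Bool → ℕ
bit true  = 1
bit false = 0

-- Reads only `does`, the Boolean on which `filter` branches, so that equivalent propositions have
-- equal indicators whatever their proofs.
𝟙 : {P : Set} → Dec P → ℕ
𝟙 P? = bit (does P?)

𝟙-cong : {P Q : Set} (P? : Dec P) (Q? : Dec Q) → P ⇔ Q → 𝟙 P? ≡ 𝟙 Q?
𝟙-cong P? Q? P⇔Q = cong bit (does-⇔ P⇔Q P? Q?)

𝟙-mono : {P Q : Set} (P? : Dec P) (Q? : Dec Q) → (P → Q) → 𝟙 P? ≤ 𝟙 Q?
𝟙-mono (no _)  _       P⇒Q = z≤n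
𝟙-mono (yes _) (yes _) P⇒Q = ≤-refl
𝟙-mono (yes p) (no ¬q) P⇒Q = contradiction (P⇒Q p) ¬q

𝟙≡0 : {P : Set} (P? : Dec P) → ¬ P → 𝟙 P? ≡ 0
𝟙≡0 (yes p) ¬p = contradiction p ¬p
𝟙≡0 (no _)  ¬p = refl

𝟙-× : {P Q : Set} (P? : Dec P) (Q? : Dec Q) → 𝟙 (P? ×-dec Q?) ≡ 𝟙 P? * 𝟙 Q?
𝟙-× P? Q? with does P? | does Q?
... | false | _     = refl
... | true  | false = refl
... | true  | true  = refl

count : {A : Set} {P : A → Set} → U.Decidable P → List A → ℕ
count P? xs = length (filter P? xs)

module _ {A : Set} {P : A → Set} (P? : U.Decidable P) where

  count-∷ : ∀ x xs → count P? (x ∷ xs) ≡ 𝟙 (P? x) + count P? xs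
  count-∷ x xs with does (P? x)
  ... | true  = refl
  ... | false = refl

  count-tabulate : ∀ {n} (f : Fin n → A) →
                   count P? (tabulate f) ≡ sum (λ i → 𝟙 (P? (f i)))
  count-tabulate {0}     f = refl
  count-tabulate {suc n} f = trans (count-∷ (f zero) (tabulate (f ∘′ suc)))
    (cong (𝟙 (P? (f zero)) +_) (count-tabulate (f ∘′ suc)))

  count-map : ∀ {B : Set} (f : B → A) xs → count P? (map f xs) ≡ count (λ x → P? (f x)) xs
  count-map f []       = refl
  count-map f (x ∷ xs) with does (P? (f x))
  ... | true  = cong suc (count-map f xs)
  ... | false = count-map f xs

count-cartesianProduct : {A B : Set} {P : A × B → Set} (P? : U.Decidable P) →
  ∀ {m n} (f : Fin m → A) (g : Fin n → B) →
  count P? (cartesianProduct (tabulate f) (tabulate g)) ≡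
  ∑[ i < m ] ∑[ j < n ] 𝟙 (P? (f i , g j))
count-cartesianProduct P? {0}     f g = refl
count-cartesianProduct P? {suc m} {n} f g = begin
  count P? (row ++ rest)
    ≡⟨ cong length (filter-++ P? row rest) ⟩
  length (filter P? row ++ filter P? rest)
    ≡⟨ length-++ (filter P? row) ⟩
  count P? row + count P? rest
    ≡⟨ cong₂ _+_
         (trans (count-map P? (f zero ,_) (tabulate g)) (count-tabulate (λ y → P? (f zero , y)) g))
         (count-cartesianProduct P? (f ∘′ suc) g) ⟩
  ∑[ i < suc m ] ∑[ j < n ] 𝟙 (P? (f i , g j)) ∎
  where
  open ≡-Reasoning
  row  = map (f zero ,_) (tabulate g)
  rest = cartesianProduct (tabulate (f ∘′ suc)) (tabulate g)

sum-𝟙-≟ : ∀ {n} (i : Fin n) → sum (λ j → 𝟙 (i Fin.≟ j)) ≡ 1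
sum-𝟙-≟ {suc n} zero    = cong suc (trans (sum-const n 0) (*-zeroʳ n))
sum-𝟙-≟ {suc n} (suc i) =
  trans (sum-cong-≗ (λ j → 𝟙-cong (suc i Fin.≟ suc j) (i Fin.≟ j) (mk⇔ Fin.suc-injective (cong suc)))) (sum-𝟙-≟ i)

-- Matchings in a single graph

module _ (G : Graph) where

  private module G = Graph G

  -- The enumeration is a bijection, so it meets `x` once. This handles the edges of `F⊛` that keep
  -- one coordinate fixed.
  count-vertices-≟ : ∀ x → count (x G.≟_) G.vertices ≡ 1
  count-vertices-≟ x = begin
    count (x G.≟_) G.vertices
      ≡⟨ count-tabulate (x G.≟_) G.vertex# ⟩
    sum (λ i → 𝟙 (x G.≟ G.vertex# i))
      ≡⟨ sum-cong-≗ (λ i → 𝟙-cong (x G.≟ G.vertex# i) (Inverse.from G.enum x Fin.≟ i) (mk⇔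
           (λ { refl → Inverse.strictlyInverseʳ G.enum i })
           (λ { refl → sym (Inverse.strictlyInverseˡ G.enum x) }))) ⟩
    sum (λ i → 𝟙 (Inverse.from G.enum x Fin.≟ i))
      ≡⟨ sum-𝟙-≟ (Inverse.from G.enum x) ⟩
    1 ∎
    where open ≡-Reasoning

module _ {G : Graph} where

  private module G = Graph G

  degree≡sum : (M : EdgeSet G) → ∀ x → degree M x ≡ sum (λ i → 𝟙 (_~?_ M x (G.vertex# i)))
  degree≡sum M x = count-tabulate (_~?_ M x) G.vertex#

  unmatched⇒degree≡0 : (M : EdgeSet G) → ∀ {x} → Unmatched M x → degree M x ≡ 0
  unmatched⇒degree≡0 M {x} u = cong length (filter-none (_~?_ M x) (All.tabulate⁺ (λ i → u (G.vertex# i))))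

  -- A neighbour `y` sits in the vertex list at the index `Inverse.from G.enum y`, which would make
  -- the filtered list non-empty.
  degree≡0⇒unmatched : (M : EdgeSet G) → ∀ {x} → degree M x ≡ 0 → Unmatched M x
  degree≡0⇒unmatched M {x} d≡0 y x~y = <⇒≢ 0<d (sym d≡0)
    where
    0<d = filter-some (_~?_ M x) (Any.tabulate⁺ (Inverse.from G.enum y)
            (subst (M ⟨ x ~_⟩) (sym (Inverse.strictlyInverseˡ G.enum y)) x~y))

  matched⇒degree≡k : ∀ {k} (M : EdgeSet G) → IsMatching k M → ∀ {x} → ¬ Unmatched M x → degree M x ≡ k
  matched⇒degree≡k M isM {x} ¬u with isM x
  ... | inj₁ d≡0 = contradiction (degree≡0⇒unmatched M d≡0) ¬u
  ... | inj₂ d≡k = d≡k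

  -- The degrees sum to the number of ordered adjacent pairs, and each edge gives two of these, one
  -- increasing and one decreasing in the enumeration.
  handshake : (M : EdgeSet G) → 2 * ∣ M ∣ ≡ sum (λ i → degree M (G.vertex# i))
  handshake M = sym (begin
    sum (λ i → degree M (G.vertex# i))
      ≡⟨ sum-cong-≗ (λ i → degree≡sum M (G.vertex# i)) ⟩
    ∑[ i < n ] ∑[ j < n ] 𝟙 (_~?_ M (G.vertex# i) (G.vertex# j))
      ≡⟨ sum-cong-≗ (λ i → sum-cong-≗ (λ j → orient i j)) ⟩
    ∑[ i < n ] ∑[ j < n ] (e i j + e j i)
      ≡⟨ sum-cong-≗ (λ i → ∑-distrib-+ (e i) (λ j → e j i)) ⟩
    ∑[ i < n ] (∑[ j < n ] e i j + ∑[ j < n ] e j i)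
      ≡⟨ ∑-distrib-+ (λ i → sum (e i)) (λ i → ∑[ j < n ] e j i) ⟩
    ∑[ i < n ] ∑[ j < n ] e i j + ∑[ i < n ] ∑[ j < n ] e j i
      -- Exchanging the two sums identifies the second double sum with the first; `+-identityʳ` is
      -- there because `2 * m` unfolds to `m + (m + 0)`.
      ≡⟨ cong₂ _+_ (sym ∣M∣≡) (trans (∑-comm (λ i j → e j i)) (trans (sym ∣M∣≡) (sym (+-identityʳ ∣ M ∣)))) ⟩
    2 * ∣ M ∣ ∎)
    where
    open ≡-Reasoning
    n = G.order
    e? : ∀ ((i , j) : Fin n × Fin n) → Dec _
    e? (i , j) = (i Fin.<? j) ×-dec _~?_ M (G.vertex# i) (G.vertex# j)
    e : Fin n → Fin n → ℕ
    e i j = 𝟙 (e? (i , j))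
    ∣M∣≡ : ∣ M ∣ ≡ ∑[ i < n ] ∑[ j < n ] e i j
    ∣M∣≡ = count-cartesianProduct e? (λ i → i) (λ j → j)
    orient : ∀ i j → 𝟙 (_~?_ M (G.vertex# i) (G.vertex# j)) ≡ e i j + e j i
    -- For distinct indices exactly one orientation can count; on the diagonal irreflexivity makes
    -- both sides zero.
    orient i j with Fin.<-cmp i j
    ... | tri< i<j _ j≮i = trans (sym (+-identityʳ _)) (cong₂ _+_
            (𝟙-cong (_~?_ M (G.vertex# i) (G.vertex# j)) (e? (i , j)) (mk⇔ (i<j ,_) proj₂)) (sym (𝟙≡0 (e? (j , i)) (j≮i ∘′ proj₁))))
    ... | tri≈ i≮i refl _ = trans (𝟙≡0 (_~?_ M (G.vertex# i) (G.vertex# i)) (G.irrefl ∘′ ~⊆E M))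
            (sym (cong₂ _+_ (𝟙≡0 (e? (i , i)) (i≮i ∘′ proj₁)) (𝟙≡0 (e? (i , i)) (i≮i ∘′ proj₁))))
    ... | tri> i≮j _ j<i = cong₂ _+_ (sym (𝟙≡0 (e? (i , j)) (i≮j ∘′ proj₁)))
            (𝟙-cong (_~?_ M (G.vertex# i) (G.vertex# j)) (e? (j , i)) (mk⇔ (λ i~j → j<i , ~-sym M i~j) (~-sym M ∘′ proj₂)))

  2∣matching∣ : ∀ {k} (M : EdgeSet G) → IsMatching k M →
                2 * ∣ M ∣ ≡ k * (G.order ∸ unmatchedCount M)
  2∣matching∣ {k} M isM = begin
    2 * ∣ M ∣
      -- Subtraction is truncated, so the identity is first proved additively in `total` and the
      -- unmatched part is then cancelled.
      ≡⟨ m+n∸n≡m (2 * ∣ M ∣) (k * unmatchedCount M) ⟨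
    2 * ∣ M ∣ + k * unmatchedCount M ∸ k * unmatchedCount M
      ≡⟨ cong (_∸ k * unmatchedCount M) total ⟩
    k * G.order ∸ k * unmatchedCount M
      ≡⟨ *-distribˡ-∸ k G.order (unmatchedCount M) ⟨
    k * (G.order ∸ unmatchedCount M) ∎
    where
    open ≡-Reasoning
    unmatched : Fin G.order → ℕ
    unmatched i = 𝟙 (unmatched? M (G.vertex# i))
    -- Each vertex contributes exactly `k`: through its degree if it is matched, through the
    -- indicator if it is not.
    local : ∀ x (u? : Dec (Unmatched M x)) → degree M x + k * 𝟙 u? ≡ k
    local x (yes u) = cong₂ _+_ (unmatched⇒degree≡0 M u) (*-identityʳ k)
    local x (no ¬u) = trans (cong₂ _+_ (matched⇒degree≡k M isM ¬u) (*-zeroʳ k)) (+-identityʳ k)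
    total : 2 * ∣ M ∣ + k * unmatchedCount M ≡ k * G.order
    total = begin
      2 * ∣ M ∣ + k * unmatchedCount M
        ≡⟨ cong₂ _+_ (handshake M)
             (trans (cong (k *_) (count-tabulate (unmatched? M) G.vertex#)) (*-distribˡ-sum k unmatched)) ⟩
      sum (λ i → degree M (G.vertex# i)) + sum (λ i → k * unmatched i)
        ≡⟨ ∑-distrib-+ (λ i → degree M (G.vertex# i)) (λ i → k * unmatched i) ⟨
      sum (λ i → degree M (G.vertex# i) + k * unmatched i)
        ≡⟨ sum-cong-≗ (λ i → local (G.vertex# i) (unmatched? M (G.vertex# i))) ⟩
      sum {G.order} (λ _ → k)
        ≡⟨ sum-const G.order k ⟩
      G.order * k
        ≡⟨ *-comm G.order k ⟩
      k * G.order ∎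

  fewer-unmatched⇒larger : ∀ {k} (M N : EdgeSet G) → IsMatching k M → IsMatching k N →
                           (∀ {x} → Unmatched N x → Unmatched M x) → ∣ M ∣ ≤ ∣ N ∣
  fewer-unmatched⇒larger {k} M N isM isN N⊆M = *-cancelˡ-≤ 2 (begin
    2 * ∣ M ∣                        ≡⟨ 2∣matching∣ M isM ⟩
    k * (G.order ∸ unmatchedCount M) ≤⟨ *-monoʳ-≤ k (∸-monoʳ-≤ G.order uN≤uM) ⟩
    k * (G.order ∸ unmatchedCount N) ≡⟨ 2∣matching∣ N isN ⟨
    2 * ∣ N ∣                        ∎)
    where
    open ≤-Reasoning
    uN≤uM : unmatchedCount N ≤ unmatchedCount M
    uN≤uM = begin
      unmatchedCount N                             ≡⟨ count-tabulate (unmatched? N) G.vertex# ⟩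
      sum (λ i → 𝟙 (unmatched? N (G.vertex# i)))   ≤⟨ sum-mono-≤ (λ i →
        𝟙-mono (unmatched? N (G.vertex# i)) (unmatched? M (G.vertex# i)) N⊆M) ⟩
      sum (λ i → 𝟙 (unmatched? M (G.vertex# i)))   ≡⟨ count-tabulate (unmatched? M) G.vertex# ⟨
      unmatchedCount M                             ∎

-- Product graphs

-- Used both for the number of unmatched vertices of `F⊛` and for its degrees, where `R` is the
-- neighbourhood of a vertex and `P` or `Q` may be equality with a fixed coordinate.
count-product : ∀ ⋆ (G H : Graph) {R : V G × V H → Set} {P : V G → Set} {Q : V H → Set}
  (R? : U.Decidable R) (P? : U.Decidable P) (Q? : U.Decidable Q) →
  (∀ g h → R (g , h) ⇔ (P g × Q h)) →
  count R? (vertices (product ⋆ G H)) ≡ count P? (vertices G) * count Q? (vertices H)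
count-product ⋆ G H R? P? Q? R⇔P×Q = begin
  count R? (vertices (product ⋆ G H))
    ≡⟨ count-tabulate R? (vertex# (product ⋆ G H)) ⟩
  sum (λ i → 𝟙 (R? (vertex# (product ⋆ G H) i)))
    ≡⟨ sum-remQuot (order G) (order H) (λ i j → 𝟙 (R? (vertex# G i , vertex# H j))) ⟩
  ∑[ i < order G ] ∑[ j < order H ] 𝟙 (R? (vertex# G i , vertex# H j))
    ≡⟨ sum-cong-≗ (λ i → sum-cong-≗ {order H} (λ j → factor (vertex# G i) (vertex# H j))) ⟩
  ∑[ i < order G ] ∑[ j < order H ] (𝟙 (P? (vertex# G i)) * 𝟙 (Q? (vertex# H j)))
    ≡⟨ sum-*-sum (λ i → 𝟙 (P? (vertex# G i))) (λ j → 𝟙 (Q? (vertex# H j))) ⟩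
  sum (λ i → 𝟙 (P? (vertex# G i))) * sum (λ j → 𝟙 (Q? (vertex# H j)))
    ≡⟨ cong₂ _*_ (count-tabulate P? (vertex# G)) (count-tabulate Q? (vertex# H)) ⟨
  count P? (vertices G) * count Q? (vertices H) ∎
  where
  open ≡-Reasoning
  factor : ∀ g h → 𝟙 (R? (g , h)) ≡ 𝟙 (P? g) * 𝟙 (Q? h)
  factor g h = trans (𝟙-cong (R? (g , h)) (P? g ×-dec Q? h) (R⇔P×Q g h))
                     (𝟙-× (P? g) (Q? h))

-- Together with `∈-collapse`, this replaces the projection condition by a disjunction: the
-- coordinate stays fixed or moves along an edge of `M`.
collapse-∈ : {G : Graph} (M : EdgeSet G) → ∀ {x y} → (x ≡ y) ⊎ M ⟨ x ~ y ⟩ → collapse G x y ∈ M ∪V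
collapse-∈ {G} M {x} {y} p with Graph._≟_ G x y
... | yes _  = tt
... | no x≢y = [ (λ x≡y → contradiction x≡y x≢y) , (λ x~y → x~y) ]′ p

∈-collapse : {G : Graph} (M : EdgeSet G) → ∀ {x y} → collapse G x y ∈ M ∪V → (x ≡ y) ⊎ M ⟨ x ~ y ⟩
∈-collapse {G} M {x} {y} p with Graph._≟_ G x y
... | yes x≡y = inj₁ x≡y
... | no _    = inj₂ p

-- Unmatched vertices and degrees of `F⊛`

module _ (⋆ : ProductKind) {G H : Graph} (MG : EdgeSet G) (MH : EdgeSet H) where

  private
    F = F⊛ ⋆ MG MH

  F⊛-weakHomPreserving : WeakHomPreserving ⋆ MG MH F
  F⊛-weakHomPreserving _ _ (inj₁ (a , b)) = collapse-∈ MG (inj₂ a) , collapse-∈ MH (inj₂ b)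
  F⊛-weakHomPreserving _ _ (inj₂ (inj₁ (e , _ , b))) = collapse-∈ MG (inj₁ e) , collapse-∈ MH (inj₂ b)
  F⊛-weakHomPreserving _ _ (inj₂ (inj₂ (e , _ , a))) = collapse-∈ MG (inj₂ a) , collapse-∈ MH (inj₁ e)

  -- An edge of `M` at `(g , h)` could move neither coordinate, since moving one requires an edge of
  -- `MG` at `g` or of `MH` at `h`; it would therefore be a loop.
  weakHom⇒unmatched : ∀ M → WeakHomPreserving ⋆ MG MH M →
    ∀ {g h} → Unmatched MG g → Unmatched MH h → Unmatched M (g , h)
  weakHom⇒unmatched M weak uG uH (g′ , h′) e with weak _ _ e
  ... | p , q with ∈-collapse MG p | ∈-collapse MH q
  ...   | inj₂ a    | _         = uG g′ a
  ...   | inj₁ _    | inj₂ b    = uH h′ b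
  ...   | inj₁ refl | inj₁ refl = Graph.irrefl (product ⋆ G H) (~⊆E M e)

  F⊛-unmatched : ∀ g h → Unmatched F (g , h) ⇔ (Unmatched MG g × Unmatched MH h)
  F⊛-unmatched g h = mk⇔
    (λ u →
      -- If `g` had an `MG`-edge, then any `MH`-edge at `h` would give an edge of `F∗` at `(g , h)`.
      -- So `h` is unmatched, and the `MG`-edge itself yields an edge of `MᵁH`. The next line is
      -- symmetric.
      (λ g′ a → u (g′ , h) (inj₂ (inj₂ (refl , (λ h′ b → u (g′ , h′) (inj₁ (a , b))) , a)))) ,
      (λ h′ b → u (g , h′) (inj₂ (inj₁ (refl , (λ g′ a → u (g′ , h′) (inj₁ (a , b))) , b)))))
    (uncurry (weakHom⇒unmatched F F⊛-weakHomPreserving))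

  unmatchedCount-F⊛ : unmatchedCount F ≡ unmatchedCount MG * unmatchedCount MH
  unmatchedCount-F⊛ = count-product ⋆ G H (unmatched? F) (unmatched? MG) (unmatched? MH) F⊛-unmatched

  -- Only `F∗` has edges at such a vertex, and its neighbourhood there is the product of the two
  -- neighbourhoods.
  degree-F⊛-matched : ∀ {g h} → ¬ Unmatched MG g → ¬ Unmatched MH h →
                      degree F (g , h) ≡ degree MG g * degree MH h
  degree-F⊛-matched {g} {h} mG mH =
    count-product ⋆ G H (_~?_ F (g , h)) (_~?_ MG g) (_~?_ MH h) (λ g′ h′ → mk⇔
      (λ { (inj₁ ab)                → ab
         ; (inj₂ (inj₁ (_ , u , _))) → contradiction u mG
         ; (inj₂ (inj₂ (_ , u , _))) → contradiction u mH })
      inj₁)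

  degree-F⊛-unmatchedˡ : ∀ {g h} → Unmatched MG g → degree F (g , h) ≡ degree MH h
  degree-F⊛-unmatchedˡ {g} {h} uG = begin
    degree F (g , h)
      -- Only `MᵁG` has edges here, so the neighbourhood is the singleton of `g` times the
      -- neighbourhood of `h`.
      ≡⟨ count-product ⋆ G H (_~?_ F (g , h)) (Graph._≟_ G g) (_~?_ MH h) (λ g′ h′ → mk⇔
           (λ { (inj₁ (a , _))            → contradiction a (uG g′)
              ; (inj₂ (inj₁ (e , _ , b))) → e , b
              ; (inj₂ (inj₂ (_ , _ , a))) → contradiction a (uG g′) })
           (λ (e , b) → inj₂ (inj₁ (e , uG , b)))) ⟩
    count (Graph._≟_ G g) (vertices G) * degree MH h
      ≡⟨ cong (_* degree MH h) (count-vertices-≟ G g) ⟩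
    1 * degree MH h
      ≡⟨ *-identityˡ (degree MH h) ⟩
    degree MH h ∎
    where open ≡-Reasoning

  degree-F⊛-unmatchedʳ : ∀ {g h} → Unmatched MH h → degree F (g , h) ≡ degree MG g
  degree-F⊛-unmatchedʳ {g} {h} uH = begin
    degree F (g , h)
      ≡⟨ count-product ⋆ G H (_~?_ F (g , h)) (_~?_ MG g) (Graph._≟_ H h) (λ g′ h′ → mk⇔
           (λ { (inj₁ (_ , b))            → contradiction b (uH h′)
              ; (inj₂ (inj₁ (_ , _ , b))) → contradiction b (uH h′)
              ; (inj₂ (inj₂ (e , _ , a))) → a , e })
           (λ (a , e) → inj₂ (inj₂ (e , uH , a)))) ⟩
    degree MG g * count (Graph._≟_ H h) (vertices H)
      ≡⟨ cong (degree MG g *_) (count-vertices-≟ H h) ⟩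
    degree MG g * 1
      ≡⟨ *-identityʳ (degree MG g) ⟩
    degree MG g ∎
    where open ≡-Reasoning

  -- `F⊛` as a `k`-matching under (M1)-(M4), and its maximality

  private
    IsDegree : ℕ → ℕ → Set
    IsDegree k d = d ≡ 0 ⊎ d ≡ k

    fromˡ : ∀ {k g h} → Unmatched MG g → IsDegree k (degree MH h) → IsDegree k (degree F (g , h))
    fromˡ uG = subst (IsDegree _) (sym (degree-F⊛-unmatchedˡ uG))

    fromʳ : ∀ {k g h} → Unmatched MH h → IsDegree k (degree MG g) → IsDegree k (degree F (g , h))
    fromʳ uH = subst (IsDegree _) (sym (degree-F⊛-unmatchedʳ uH))

    fromBoth : ∀ {kG kH k g h} → kG * kH ≡ k → IsMatching kG MG → IsMatching kH MH →
               ¬ Unmatched MG g → ¬ Unmatched MH h → IsDegree k (degree F (g , h))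
    fromBoth kGkH≡k isG isH mG mH = inj₂ (trans (degree-F⊛-matched mG mH)
      (trans (cong₂ _*_ (matched⇒degree≡k MG isG mG) (matched⇒degree≡k MH isH mH)) kGkH≡k))

  -- If just one coordinate is unmatched, the degree is that of the other one, so this may happen
  -- only where the other factor carries a `k`-matching. Perfectness in (M1a), (M2a) and (M4)
  -- excludes the remaining cases. Where both are matched, the degrees multiply to `k * 1`, `1 * k`,
  -- `1 * 1` or `kG * kH`.
  condition⇒F⊛-isMatching : ∀ {k} → Condition k MG MH → IsMatching k F
  condition⇒F⊛-isMatching {k} (M1a (isG , perfG) isH _) (g , h) =
    [ (λ uH → fromʳ uH (isG g))
    , fromBoth (*-identityʳ k) isG isH (perfG g)
    ]′ (toSum (unmatched? MH h))
  condition⇒F⊛-isMatching (M1b isG _ emptyH) (g , h) = fromʳ (emptyH h) (isG g)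
  condition⇒F⊛-isMatching {k} (M2a isG _ (isH , perfH)) (g , h) =
    [ (λ uG → fromˡ uG (isH h))
    , (λ mG → fromBoth (*-identityˡ k) isG isH mG (perfH h))
    ]′ (toSum (unmatched? MG g))
  condition⇒F⊛-isMatching (M2b emptyG isH _) (g , h) = fromˡ (emptyG g) (isH h)
  condition⇒F⊛-isMatching (M3 refl isG isH) (g , h) =
    [ (λ uG → fromˡ uG (isH h))
    , (λ mG → [ (λ uH → fromʳ uH (isG g))
              , fromBoth refl isG isH mG
              ]′ (toSum (unmatched? MH h)))
    ]′ (toSum (unmatched? MG g))
  condition⇒F⊛-isMatching (M4 _ _ _ _ kGkH≡k (isG , perfG) (isH , perfH)) (g , h) =
    fromBoth kGkH≡k isG isH (perfG g) (perfH h)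

  F⊛-largest : ∀ {k} → IsMatching k F → ∀ M → W ⋆ MG MH k M → ∣ M ∣ ≤ ∣ F ∣
  F⊛-largest isF M (isM , weak) = fewer-unmatched⇒larger M F isM isF
    (λ {x} u → uncurry (weakHom⇒unmatched M weak) (Equivalence.to (F⊛-unmatched (proj₁ x) (proj₂ x)) u))

mainTheorem15 : (⋆ : ProductKind) (k : ℕ) → NonZero k →
    (G H : Graph) (MG : EdgeSet G) (MH : EdgeSet H) →
    (IsMatching k (F⊛ ⋆ MG MH) →
    W ⋆ MG MH k (F⊛ ⋆ MG MH) ×
    (∀ M → W ⋆ MG MH k M → ∣ M ∣ ≤ ∣ F⊛ ⋆ MG MH ∣))
    ×
    (Condition k MG MH →
    ∀ M* → IsMaximumW ⋆ MG MH k M* →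
    2 * ∣ M* ∣ ≡ k * (Graph.order G * Graph.order H ∸ unmatchedCount MG * unmatchedCount MH))
mainTheorem15 ⋆ k _ G H MG MH =
  (λ isF → (isF , F⊛-weakHomPreserving ⋆ MG MH) , F⊛-largest ⋆ MG MH isF) ,
  λ c M* (wM* , max) → let isF = condition⇒F⊛-isMatching ⋆ MG MH c in begin
    2 * ∣ M* ∣
      -- `F⊛` itself belongs to the class over which `M*` is maximal, so each of the two bounds the
      -- other.
      ≡⟨ cong (2 *_) (≤-antisym (F⊛-largest ⋆ MG MH isF M* wM*)
                                (max (F⊛ ⋆ MG MH) (isF , F⊛-weakHomPreserving ⋆ MG MH))) ⟩
    2 * ∣ F⊛ ⋆ MG MH ∣
      ≡⟨ 2∣matching∣ (F⊛ ⋆ MG MH) isF ⟩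
    k * (order G * order H ∸ unmatchedCount (F⊛ ⋆ MG MH))
      ≡⟨ cong (λ u → k * (order G * order H ∸ u)) (unmatchedCount-F⊛ ⋆ MG MH) ⟩
    k * (order G * order H ∸ unmatchedCount MG * unmatchedCount MH) ∎
  where open ≡-Reasoning
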